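{- Let $k\geq2$. Then $$F_k(x,p)=\sum_{j=0}^{k-2}J_j(p)x^j+\frac{x^{k-1}}{1-(k-1)x^2}\bigl((k-1)J_{k-2}(p)x+J_{k-1}(p)\bigr).$$ Moreover, for all $n\geq0$, the number of involutions of length $k+2n$ that avoid all patterns in $\mathcal{F}_k$ is $(k-1)^{n+1}I_{k-2}$, and the number of involutions of length $k+2n-1$ that avoid all patterns in $\mathcal{F}_k$ is $(k-1)^nI_{k-1}$.
   Context: $\mathcal{F}_k=\{\sigma\in\mathfrak{S}_k:\sigma_1=1\}$. An involution is a permutation $\pi$ with $\pi_{\pi_i}=i$ for all $i$; $\mathcal{I}_n(T)$ is the set of involutions of $[n]$ avoiding (in the classical pattern sense) every pattern in $T$; $\mathcal{I}_0$ contains only the empty permutation. $I_n$ is the number of involutions of $[n]$. $J_n(p)=\sum_{\pi\in\mathcal{I}_n}p^{\mathrm{fix}(\pi)}$, where $\mathrm{fix}(\pi)$ is the number of fixed points; $J_0=1,J_1=p$, $J_n=pJ_{n-1}+(n-1)J_{n-2}$. $F_k(x,p)=\sum_{n\ge0}\sum_{\pi\in\mathcal{I}_n(\mathcal{F}_k)}p^{\mathrm{fix}(\pi)}x^n$. -}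

module Defs where

open import Algebra.Bundles using (CommutativeRing; Semiring)
import Algebra.Construct.Pointwise as Pointwise
import Algebra.Definitions as AlgDefs
import Algebra.Definitions.RawSemiring as RawSemiringDefs
import Algebra.Properties.CommutativeMonoid.Sum as CMSum
import Algebra.Properties.Semiring.Sum as SemiringSum
open import Data.Fin.Base as Fin using (Fin; toℕ)
import Data.Fin.Properties as Fin
open import Data.Integer.Properties using (+-*-commutativeRing)
open import Data.List.Base as List using (List; allFin; cartesianProductWith; filter; length)
open import Data.List.Membership.Propositional using (_∈_; lose)
open import Data.List.Membership.Propositional.Properties using (∈-allFin; ∈-cartesianProductWith⁺)
open import Data.List.Relation.Unary.All as All using ()
open import Data.List.Relation.Unary.Any as Any using (here)
open import Data.List.Relation.Unary.AllPairs using ([]; _∷_)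
open import Data.List.Relation.Unary.All using ([])
open import Data.List.Relation.Unary.Unique.Propositional using (Unique)
import Data.List.Relation.Unary.Unique.Propositional.Properties as Unique
open import Data.Nat.Base as ℕ using (ℕ; zero; suc; _∸_)
import Data.Nat.Properties as ℕ
open import Data.Product.Base using (_×_; _,_; ∃; map₂)
open import Data.Vec.Base using (Vec; []; _∷_; lookup)
open import Data.Vec.Functional as Vector using (Vector)
open import Data.Vec.Properties using (∷-injective)
open import Function.Base using (_∘_; _$_)
open import Function.Bundles using (_⇔_; mk⇔; Equivalence)
open import Function.Definitions using (Injective; Surjective; Bijective)
open import Level using (0ℓ)
open import Relation.Binary.Core using (_Preserves_⟶_)
open import Relation.Binary.PropositionalEquality as ≡ using (_≡_; refl; cong)
open import Relation.Nullary.Decidable using (Dec; map′; _×-dec_; _→-dec_; ¬?)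
open import Relation.Nullary.Negation using (¬_)
open import Relation.Unary using (Pred; Decidable)

-- Words of length m over an n-letter alphabet.  Positions and letters are
-- counted from 0: position i and letter j stand for i + 1 and j + 1.

Word : ℕ → ℕ → Set
Word m n = Vec (Fin n) m

words : ∀ m n → List (Word m n)
words zero    n = [] List.∷ List.[]
words (suc m) n = cartesianProductWith _∷_ (allFin n) (words m n)

∈-words : ∀ {m n} (w : Word m n) → w ∈ words m n
∈-words []      = here refl
∈-words (a ∷ w) = ∈-cartesianProductWith⁺ _∷_ (∈-allFin a) (∈-words w)

words-unique : ∀ m n → Unique (words m n)
words-unique zero    n = [] ∷ []
words-unique (suc m) n =
  Unique.cartesianProductWith⁺ _∷_ ∷-injective (Unique.allFin⁺ n) (words-unique m n)

module _ {m n : ℕ} {P : Pred (Word m n) 0ℓ} (P? : Decidable P) where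

  anyWord? : Dec (∃ P)
  anyWord? = map′ Any.satisfied (λ (w , pw) → lose (∈-words w) pw) (Any.any? P? (words m n))

  allWords? : Dec (∀ w → P w)
  allWords? = map′ (λ all w → All.lookup all (∈-words w)) (λ all → All.tabulate λ {w} _ → all w)
                   (All.all? P? (words m n))

-- Permutations are given in one-line notation.
IsPermutation : ∀ {n} → Word n n → Set
IsPermutation π = Bijective _≡_ _≡_ (lookup π)

isPermutation? : ∀ {n} → Decidable (IsPermutation {n})
isPermutation? π = injective? ×-dec surjective?
  where
  injective? : Dec (Injective _≡_ _≡_ (lookup π))
  injective? = map′ (λ inj {x} {y} → inj x y) (λ inj x y → inj {x} {y})
    (Fin.all? λ x → Fin.all? λ y → (lookup π x Fin.≟ lookup π y) →-dec (x Fin.≟ y))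

  surjective? : Dec (Surjective _≡_ _≡_ (lookup π))
  surjective? = map′
    (λ surj y → map₂ (λ πx≡y {z} z≡x → ≡.trans (cong (lookup π) z≡x) πx≡y) (surj y))
    (λ surj y → map₂ (λ f → f refl) (surj y))
    (Fin.all? λ y → Fin.any? λ x → lookup π x Fin.≟ y)

IsInvolution : ∀ {n} → Word n n → Set
IsInvolution π = IsPermutation π × AlgDefs.Involutive _≡_ (lookup π)

isInvolution? : ∀ {n} → Decidable (IsInvolution {n})
isInvolution? π = isPermutation? π ×-dec Fin.all? λ i → lookup π (lookup π i) Fin.≟ i

fix : ∀ {n} → Word n n → ℕ
fix {n} π = length (filter (λ i → lookup π i Fin.≟ i) (allFin n))

IsOccurrence : ∀ {k n} → Word k k → Word n n → Word k n → Set
IsOccurrence σ π ι =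
  (lookup ι Preserves Fin._<_ ⟶ Fin._<_) ×
  (∀ a b → (lookup π (lookup ι a) Fin.< lookup π (lookup ι b)) ⇔ (lookup σ a Fin.< lookup σ b))

isOccurrence? : ∀ {k n} (σ : Word k k) (π : Word n n) → Decidable (IsOccurrence σ π)
isOccurrence? σ π ι =
  map′ (λ inc {a} {b} → inc a b) (λ inc a b → inc {a} {b})
    (Fin.all? λ a → Fin.all? λ b → (a Fin.<? b) →-dec (lookup ι a Fin.<? lookup ι b))
  ×-dec
  Fin.all? λ a → Fin.all? λ b →
    let π<? = lookup π (lookup ι a) Fin.<? lookup π (lookup ι b)
        σ<? = lookup σ a Fin.<? lookup σ b
    in map′ (λ (to , from) → mk⇔ to from)
            (λ eqv → Equivalence.to eqv , Equivalence.from eqv)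
            ((π<? →-dec σ<?) ×-dec (σ<? →-dec π<?))

Contains : ∀ {k n} → Word n n → Word k k → Set
Contains π σ = ∃ (IsOccurrence σ π)

contains? : ∀ {k n} (π : Word n n) (σ : Word k k) → Dec (Contains π σ)
contains? π σ = anyWord? (isOccurrence? σ π)

Avoids : ∀ {k n} → Pred (Word k k) 0ℓ → Word n n → Set
Avoids T π = ∀ σ → T σ → ¬ Contains π σ

avoids? : ∀ {k n} {T : Pred (Word k k) 0ℓ} → Decidable T → Decidable (Avoids {k} {n} T)
avoids? T? π = allWords? λ σ → T? σ →-dec ¬? (contains? π σ)

-- Permutations of length k sending the first position to the smallest
-- letter; at k = 0 there is no first position and the condition is vacuous.
𝓕 : ∀ k → Pred (Word k k) 0ℓ
𝓕 k σ = IsPermutation σ × (∀ i → toℕ i ≡ 0 → toℕ (lookup σ i) ≡ 0)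

𝓕? : ∀ k → Decidable (𝓕 k)
𝓕? k σ = isPermutation? σ ×-dec
  Fin.all? λ i → (toℕ i ℕ.≟ 0) →-dec (toℕ (lookup σ i) ℕ.≟ 0)

-- By ∈-words and words-unique, the filtered lists below have no repetitions
-- or omissions.
involutions : ∀ n → List (Word n n)
involutions n = filter isInvolution? (words n n)

involutionsAvoiding : ∀ {k} {T : Pred (Word k k) 0ℓ} → Decidable T → ∀ n → List (Word n n)
involutionsAvoiding T? n = filter (avoids? T?) (involutions n)

I : ℕ → ℕ
I n = length (involutions n)

module PowerSeries {c ℓ} (R : CommutativeRing c ℓ) where

  open CommutativeRing R renaming (refl to ≈-refl; sym to ≈-sym; trans to ≈-trans)
  open SemiringSum semiring using (sum; *-distribˡ-sum)
  open CMSum +-commutativeMonoid using (sum-cong-≋; ∑-distrib-+)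
  open import Relation.Binary.Reasoning.Setoid setoid

  -- f n is the coefficient of the n-th power of the variable.
  Series : Set c
  Series = ℕ → Carrier

  infix 4 _≋_
  _≋_ : Series → Series → Set ℓ
  f ≋ g = ∀ n → f n ≈ g n

  infixl 7 _⊛_
  _⊛_ : Series → Series → Series
  (f ⊛ g) n = sum {suc n} (λ i → f (toℕ i) * g (n ∸ toℕ i))

  constant : Carrier → Series
  constant a zero    = a
  constant a (suc n) = 0#

  X : Series
  X (suc zero) = 1#
  X _          = 0#

  private
    infixl 6 _⊕_
    _⊕_ : Series → Series → Series
    (f ⊕ g) n = f n + g n

    infixr 7 _•_
    _•_ : Carrier → Series → Series
    (a • f) n = a * f n

    tail : Series → Series
    tail f = f ∘ suc

    ⊛-cong : ∀ {f f′ g g′} → f ≋ f′ → g ≋ g′ → f ⊛ g ≋ f′ ⊛ g′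
    ⊛-cong f≋ g≋ n = sum-cong-≋ {suc n} λ i → *-cong (f≋ (toℕ i)) (g≋ (n ∸ toℕ i))

    ⊛-distribʳ : ∀ h f g → (f ⊕ g) ⊛ h ≋ f ⊛ h ⊕ g ⊛ h
    ⊛-distribʳ h f g n = ≈-trans
      (sum-cong-≋ {suc n} λ i → distribʳ (h (n ∸ toℕ i)) (f (toℕ i)) (g (toℕ i)))
      (∑-distrib-+ {suc n} (λ i → f (toℕ i) * h (n ∸ toℕ i)) (λ i → g (toℕ i) * h (n ∸ toℕ i)))

    •-⊛ : ∀ a f g → (a • f) ⊛ g ≋ a • (f ⊛ g)
    •-⊛ a f g n = ≈-trans
      (sum-cong-≋ {suc n} λ i → *-assoc a (f (toℕ i)) (g (n ∸ toℕ i)))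
      (≈-sym (*-distribˡ-sum {suc n} a (λ i → f (toℕ i) * g (n ∸ toℕ i))))

    ⊛-assoc : ∀ f g h → (f ⊛ g) ⊛ h ≋ f ⊛ (g ⊛ h)
    ⊛-assoc f g h zero = +-congʳ $ begin
      (f 0 * g 0 + 0#) * h 0   ≈⟨ *-congʳ (+-identityʳ _) ⟩
      f 0 * g 0 * h 0          ≈⟨ *-assoc _ _ _ ⟩
      f 0 * (g 0 * h 0)        ≈⟨ *-congˡ (+-identityʳ _) ⟨
      f 0 * (g 0 * h 0 + 0#)   ∎
    ⊛-assoc f g h (suc n) = begin
      (f 0 * g 0 + 0#) * h (suc n) + ((f 0 • tail g ⊕ tail f ⊛ g) ⊛ h) n
        ≈⟨ +-cong (*-congʳ (+-identityʳ _)) (⊛-distribʳ h (f 0 • tail g) (tail f ⊛ g) n) ⟩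
      f 0 * g 0 * h (suc n) + (((f 0 • tail g) ⊛ h) n + ((tail f ⊛ g) ⊛ h) n)
        ≈⟨ +-cong (*-assoc _ _ _) (+-cong (•-⊛ (f 0) (tail g) h n) (⊛-assoc (tail f) g h n)) ⟩
      f 0 * (g 0 * h (suc n)) + (f 0 * (tail g ⊛ h) n + (tail f ⊛ (g ⊛ h)) n)
        ≈⟨ +-assoc _ _ _ ⟨
      f 0 * (g 0 * h (suc n)) + f 0 * (tail g ⊛ h) n + (tail f ⊛ (g ⊛ h)) n
        ≈⟨ +-congʳ (distribˡ _ _ _) ⟨
      f 0 * (g 0 * h (suc n) + (tail g ⊛ h) n) + (tail f ⊛ (g ⊛ h)) n ∎

    ⊛-last : ∀ f g n → (f ⊛ g) (suc n) ≈ (f ⊛ tail g) n + f (suc n) * g 0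
    ⊛-last f g zero    = begin
      f 0 * g 1 + (f 1 * g 0 + 0#)   ≈⟨ +-congˡ (+-identityʳ _) ⟩
      f 0 * g 1 + f 1 * g 0          ≈⟨ +-congʳ (+-identityʳ _) ⟨
      f 0 * g 1 + 0# + f 1 * g 0     ∎
    ⊛-last f g (suc n) = ≈-trans (+-congˡ (⊛-last (tail f) g n)) (≈-sym (+-assoc _ _ _))

    ⊛-comm : ∀ f g → f ⊛ g ≋ g ⊛ f
    ⊛-comm f g zero    = +-congʳ (*-comm _ _)
    ⊛-comm f g (suc n) = begin
      f 0 * g (suc n) + (tail f ⊛ g) n   ≈⟨ +-cong (*-comm _ _) (⊛-comm (tail f) g n) ⟩
      g (suc n) * f 0 + (g ⊛ tail f) n   ≈⟨ +-comm _ _ ⟩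
      (g ⊛ tail f) n + g (suc n) * f 0   ≈⟨ ⊛-last g f n ⟨
      (g ⊛ f) (suc n)                    ∎

    ⊛-zeroˡ : ∀ f n → ((λ _ → 0#) ⊛ f) n ≈ 0#
    ⊛-zeroˡ f zero    = ≈-trans (+-identityʳ _) (zeroˡ _)
    ⊛-zeroˡ f (suc n) = ≈-trans (+-cong (zeroˡ _) (⊛-zeroˡ f n)) (+-identityʳ _)

    ⊛-identityˡ : ∀ f → constant 1# ⊛ f ≋ f
    ⊛-identityˡ f zero    = ≈-trans (+-identityʳ _) (*-identityˡ _)
    ⊛-identityˡ f (suc n) = ≈-trans (+-cong (*-identityˡ _) (⊛-zeroˡ f n)) (+-identityʳ _)

  powerSeriesRing : CommutativeRing c ℓ
  powerSeriesRing = record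
    { Carrier = Series
    ; _≈_ = _≋_
    ; _+_ = _⊕_
    ; _*_ = _⊛_
    ; -_  = λ f n → - f n
    ; 0#  = λ _ → 0#
    ; 1#  = constant 1#
    ; isCommutativeRing = record
      { isRing = record
        { +-isAbelianGroup = Pointwise.isAbelianGroup ℕ +-isAbelianGroup
        ; *-cong = ⊛-cong
        ; *-assoc = ⊛-assoc
        ; *-identity = ⊛-identityˡ , λ f n → ≈-trans (⊛-comm f (constant 1#) n) (⊛-identityˡ f n)
        ; distrib = (λ f g h n → begin
              (f ⊛ (g ⊕ h)) n          ≈⟨ ⊛-comm f (g ⊕ h) n ⟩
              ((g ⊕ h) ⊛ f) n          ≈⟨ ⊛-distribʳ f g h n ⟩
              (g ⊛ f) n + (h ⊛ f) n    ≈⟨ +-cong (⊛-comm g f n) (⊛-comm h f n) ⟩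
              (f ⊛ g) n + (f ⊛ h) n    ∎)
          , ⊛-distribʳ
        }
      ; *-comm = ⊛-comm
      }
    }

  -- 1 / f for a series f with constant term 1 (f⊛recip below); no meaning is
  -- attached to recip f for other f.  recipUpTo f n lists the coefficients
  -- of 1 / f of index n, n - 1, …, 0.
  recipUpTo : Series → ∀ n → Vector Carrier (suc n)
  recipUpTo f zero    = 1# Vector.∷ Vector.[]
  recipUpTo f (suc n) =
    (- sum (λ i → f (suc (toℕ i)) * recipUpTo f n i)) Vector.∷ recipUpTo f n

  recip : Series → Series
  recip f n = recipUpTo f n Fin.zero

  recipUpTo-recip : ∀ f n i → recipUpTo f n i ≡ recip f (n ∸ toℕ i)
  recipUpTo-recip f zero    Fin.zero    = refl
  recipUpTo-recip f (suc n) Fin.zero    = refl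
  recipUpTo-recip f (suc n) (Fin.suc i) = recipUpTo-recip f n i

  f⊛recip : ∀ f → f 0 ≈ 1# → f ⊛ recip f ≋ constant 1#
  f⊛recip f f0≈1 zero    = begin
    f 0 * 1# + 0#   ≈⟨ +-identityʳ _ ⟩
    f 0 * 1#        ≈⟨ *-identityʳ _ ⟩
    f 0             ≈⟨ f0≈1 ⟩
    1#              ∎
  f⊛recip f f0≈1 (suc n) = begin
    f 0 * (- s) + (tail f ⊛ recip f) n
      ≈⟨ +-cong (*-congʳ f0≈1) (sum-cong-≋ {suc n} λ i →
           *-congˡ {x = f (suc (toℕ i))} (reflexive (≡.sym (recipUpTo-recip f n i)))) ⟩
    1# * (- s) + s   ≈⟨ +-congʳ (*-identityˡ _) ⟩
    - s + s          ≈⟨ -‿inverseˡ s ⟩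
    0#               ∎
    where s = sum (λ i → f (suc (toℕ i)) * recipUpTo f n i)

  private
    module S = CommutativeRing powerSeriesRing
    module S^ = RawSemiringDefs (Semiring.rawSemiring S.semiring)

  recip-1-mX² : ∀ m → let d = S.1# S.- (m S^.× X S^.^ 2) in d ⊛ recip d ≋ S.1#
  recip-1-mX² m = f⊛recip (S.1# S.- (m S^.× X S^.^ 2)) (begin
    1# + - (m S^.× X S^.^ 2) 0   ≈⟨ +-congˡ (-‿cong (constantTerm m)) ⟩
    1# + - 0#                    ≈⟨ +-congˡ (≈-trans (≈-sym (+-identityˡ _)) (-‿inverseʳ 0#)) ⟩
    1# + 0#                      ≈⟨ +-identityʳ 1# ⟩
    1#                           ∎)
    where
    constantTerm : ∀ m → (m S^.× X S^.^ 2) 0 ≈ 0#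
    constantTerm zero    = ≈-refl
    constantTerm (suc m) = begin
      (0# * (X S^.^ 1) 0 + 0#) + (m S^.× X S^.^ 2) 0
        ≈⟨ +-cong (≈-trans (+-identityʳ _) (zeroˡ _)) (constantTerm m) ⟩
      0# + 0#   ≈⟨ +-identityʳ 0# ⟩
      0#        ∎

-- Identities in p and x live in (ℤ[[p]])[[x]]: the coefficient of p^m x^n
-- in f is f n m.  The ring ℤ[p][[x]] embeds in it.

module ℤ⟦p⟧ = PowerSeries +-*-commutativeRing

ℤ⟦p⟧-ring : CommutativeRing 0ℓ 0ℓ
ℤ⟦p⟧-ring = ℤ⟦p⟧.powerSeriesRing

module ℤ⟦p⟧⟦x⟧ = PowerSeries ℤ⟦p⟧-ring

ℤ⟦p⟧⟦x⟧-ring : CommutativeRing 0ℓ 0ℓ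
ℤ⟦p⟧⟦x⟧-ring = ℤ⟦p⟧⟦x⟧.powerSeriesRing

p : ℤ⟦p⟧.Series
p = ℤ⟦p⟧.X

x : ℤ⟦p⟧⟦x⟧.Series
x = ℤ⟦p⟧⟦x⟧.X

private
  module A = CommutativeRing ℤ⟦p⟧-ring
  module A^ = RawSemiringDefs (Semiring.rawSemiring A.semiring)

fixEnumerator : ∀ {n} → List (Word n n) → ℤ⟦p⟧.Series
fixEnumerator = List.foldr (λ π s → (p A^.^ fix π) A.+ s) A.0#

J : ℕ → ℤ⟦p⟧.Series
J n = fixEnumerator (involutions n)

F : ℕ → ℤ⟦p⟧⟦x⟧.Series
F k n = fixEnumerator (involutionsAvoiding (𝓕? k) n)

-- m · f is the m-fold sum f ⊕ ⋯ ⊕ f, and f ↑ m the m-th power.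
open CommutativeRing ℤ⟦p⟧⟦x⟧-ring public
  using (_≈_) renaming (_+_ to infixl 6 _⊕_; _-_ to infixl 6 _⊖_; _*_ to infixl 7 _⊛_; 1# to 𝟙)
open RawSemiringDefs (Semiring.rawSemiring (CommutativeRing.semiring ℤ⟦p⟧⟦x⟧-ring)) public
  using (sum) renaming (_×_ to infixr 8 _·_; _^_ to infixr 9 _↑_)
open ℤ⟦p⟧⟦x⟧ public using (constant; recip)

-- An involution avoids 𝓕 k exactly when no entry has k - 1 or more larger
-- entries to its right.  For n ≥ k this forces its first letter v to be one of
-- the k - 1 largest, so the first position lies in a 2-cycle.  Conversely, that
-- 2-cycle can be inserted into any avoiding involution of length n - 2, for
-- each of the k - 1 values of v, without changing the larger-entries-to-the-
-- right count of any old entry.  Hence F k n = (k - 1) · F k (n - 2) for n ≥ k,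
-- while F k n = J n for n < k; solving this recurrence gives both claims.

module Submission where

open import Defs
open import Data.Nat.Base using (ℕ; _≤_; _+_; _*_; _∸_; _^_)
open import Data.Fin.Base using (toℕ)
open import Data.List.Base using (length)
open import Data.Product.Base using (_×_)
open import Relation.Binary.PropositionalEquality using (_≡_)

open import Algebra.Bundles using (CommutativeRing; Semiring)
open import Algebra.Consequences.Propositional using (selfInverse⇒bijective)
import Algebra.Definitions as AlgDefs
import Algebra.Definitions.RawSemiring as RawSemiringDefs
import Algebra.Properties.Monoid.Mult as MonoidMult
import Algebra.Properties.Ring as RingProperties
import Algebra.Properties.Semiring.Mult as SemiringMult
import Algebra.Properties.Semiring.Sum as SemiringSum
open import Data.Fin.Base using (Fin; zero; suc; _<_; fromℕ<; inject≤; opposite; punchIn; punchOut)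
open import Data.Fin.Properties
open import Data.Fin.Subset using (Subset; _∈_; ∣_∣)
open import Data.Fin.Subset.Properties using (∈⊤; ∣⊤∣≡n; p⊂q⇒∣p∣<∣q∣)
open import Data.List.Base as List using (List; []; _∷_; _++_; allFin; cartesianProductWith; filter)
import Data.List.Membership.Propositional as List
import Data.List.Membership.Propositional.Properties as List
open import Data.List.Membership.Propositional.Properties.WithK using (unique∧set⇒bag)
import Data.List.Properties as List
open import Data.List.Relation.Binary.BagAndSetEquality using (∼bag⇒↭)
open import Data.List.Relation.Binary.Permutation.Propositional as ↭ using (_↭_)
open import Data.List.Relation.Binary.Permutation.Propositional.Properties using (↭-length)
import Data.List.Relation.Unary.All as All
open import Data.List.Relation.Unary.Unique.Propositional using (Unique)
import Data.List.Relation.Unary.Unique.Propositional.Properties as Unique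
open import Data.Nat.Base as ℕ using (zero; suc; z≤n; s≤s)
import Data.Nat.Properties as ℕ
open import Data.Product.Base using (_,_; ∃; ∃₂; proj₁; proj₂)
open import Data.Vec.Base as Vec using (Vec; lookup; tabulate; insertAt)
import Data.Vec.Properties as Vec
open import Data.Vec.Relation.Binary.Pointwise.Extensional using (ext; Pointwise-≡⇒≡)
open import Function.Base using (_∘_; case_of_)
open import Function.Bundles using (_⇔_; mk⇔; Equivalence)
open import Function.Construct.Composition using (_⇔-∘_)
open import Function.Definitions using (Injective)
open import Function.Properties.Equivalence using () renaming (sym to ⇔-sym)
open import Relation.Binary.Core using (_Preserves_⟶_)
open import Relation.Binary.Definitions using (tri<; tri≈; tri>)
open import Relation.Binary.PropositionalEquality as ≡ using (_≢_; refl; cong; cong₂; sym; trans; subst; subst₂)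
open import Relation.Nullary.Decidable using (does; proof; yes; no; dec-true)
open import Relation.Nullary.Reflects using (Reflects; invert)
open import Relation.Nullary.Negation using (¬_; contradiction)
open import Relation.Unary using (Decidable)

private
  variable
    m n k : ℕ

-- Injections between finite sets

lookup-ext : ∀ {A : Set} {u v : Vec A n} → (∀ i → lookup u i ≡ lookup v i) → u ≡ v
lookup-ext u≗v = Pointwise-≡⇒≡ (ext u≗v)

-- Pigeonhole: if `y` were missed, removing it from the codomain with `punchOut` would inject
-- `suc n` elements into `n`.
injective⇒surjective : ∀ {f : Fin n → Fin n} → Injective _≡_ _≡_ f → ∀ y → ∃ λ i → f i ≡ y
injective⇒surjective {suc n} {f} inj y with any? (λ i → f i ≟ y)
... | yes hit = hit
... | no miss = contradiction
  (injective⇒≤ {f = λ i → punchOut {i = y} (λ y≡fi → miss (i , sym y≡fi))}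
     (λ {i} {j} eq → inj (punchOut-injective {i = y} _ _ eq)))
  ℕ.1+n≰n

opposite-injective : Injective _≡_ _≡_ (opposite {n})
opposite-injective {x = i} {y = j} eq =
  trans (sym (opposite-involutive i)) (trans (cong opposite eq) (opposite-involutive j))

-- Reversal by `opposite` turns values greater than `u` into values smaller than `n ∸ suc u`, so `f`
-- becomes an injection into a set of that size.
injective-above⇒≤ : ∀ {u} {f : Fin m → Fin n} → Injective _≡_ _≡_ f →
                    (∀ i → u ℕ.< toℕ (f i)) → m ≤ n ∸ suc u
injective-above⇒≤ {n = n} {u} {f} inj u<f = injective⇒≤ {f = g} g-injective
  where
  bound : ∀ i → toℕ (opposite (f i)) ℕ.< n ∸ suc u
  bound i = subst (ℕ._< n ∸ suc u) (sym (opposite-prop (f i)))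
    (ℕ.∸-monoʳ-< {n} (s≤s (u<f i)) (toℕ<n (f i)))

  g = λ i → fromℕ< (bound i)

  g-injective : Injective _≡_ _≡_ g
  g-injective {i} {j} eq = inj (opposite-injective (toℕ-injective
    (fromℕ<-injective _ _ (bound i) (bound j) eq)))

increasing⇒injective : ∀ {f : Fin m → Fin n} → f Preserves _<_ ⟶ _<_ → Injective _≡_ _≡_ f
increasing⇒injective inc {i} {j} eq with <-cmp i j
... | tri< i<j _ _ = contradiction eq (<⇒≢ (inc i<j))
... | tri≈ _ i≡j _ = i≡j
... | tri> _ _ j<i = contradiction (sym eq) (<⇒≢ (inc j<i))

-- Standardization

module Standardization {k n : ℕ} (f : Fin k → Fin n) where

  -- Encoded as a subset so that comparing two values of `f` becomes strict inclusion, and ranks are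
  -- compared as cardinalities.
  below : Fin k → Subset k
  below a = tabulate λ b → does (f b <? f a)

  ∈-below⁺ : ∀ {a b} → f b < f a → b ∈ below a
  ∈-below⁺ {a} {b} lt = Vec.lookup⇒[]= b (below a)
    (trans (Vec.lookup∘tabulate _ b) (dec-true (f b <? f a) lt))

  ∈-below⁻ : ∀ {a b} → b ∈ below a → f b < f a
  ∈-below⁻ {a} {b} b∈ = invert (subst (Reflects (f b < f a))
    (trans (sym (Vec.lookup∘tabulate _ b)) (Vec.[]=⇒lookup b∈)) (proof (f b <? f a)))

  rank : Fin k → ℕ
  rank a = ∣ below a ∣

  ∉-below : ∀ {a} → ¬ a ∈ below a
  ∉-below a∈ = ℕ.n≮n _ (∈-below⁻ a∈)

  rank< : ∀ a → rank a ℕ.< k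
  rank< a = subst (rank a ℕ.<_) (∣⊤∣≡n k) (p⊂q⇒∣p∣<∣q∣ ((λ _ → ∈⊤) , a , ∈⊤ , ∉-below))

  rank-mono-< : ∀ {a b} → f a < f b → rank a ℕ.< rank b
  rank-mono-< {a} lt = p⊂q⇒∣p∣<∣q∣
    ((λ c∈ → ∈-below⁺ (<-trans (∈-below⁻ c∈) lt)) , a , ∈-below⁺ lt , ∉-below)

  rank-cancel-< : ∀ {a b} → rank a ℕ.< rank b → f a < f b
  rank-cancel-< {a} {b} lt with <-cmp (f a) (f b)
  ... | tri< fa<fb _ _ = fa<fb
  ... | tri≈ _ fa≡fb _ = contradiction lt
    (ℕ.<-irrefl (cong (λ y → ∣ tabulate (λ c → does (f c <? y)) ∣) fa≡fb))
  ... | tri> _ _ fb<fa = contradiction lt (ℕ.<-asym (rank-mono-< fb<fa))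

  standardize : Word k k
  standardize = tabulate λ a → fromℕ< (rank< a)

  toℕ-standardize : ∀ a → toℕ (lookup standardize a) ≡ rank a
  toℕ-standardize a = trans (cong toℕ (Vec.lookup∘tabulate _ a)) (toℕ-fromℕ< (rank< a))

  standardize-< : ∀ a b → (f a < f b) ⇔ (lookup standardize a < lookup standardize b)
  standardize-< a b = mk⇔
    (subst₂ ℕ._<_ (sym (toℕ-standardize a)) (sym (toℕ-standardize b)) ∘ rank-mono-<)
    (rank-cancel-< ∘ subst₂ ℕ._<_ (toℕ-standardize a) (toℕ-standardize b))

  standardize-isPermutation : Injective _≡_ _≡_ f → IsPermutation standardize
  standardize-isPermutation inj = σ-injective , λ y →
    let a , σa≡y = injective⇒surjective σ-injective y
    in a , λ z≡a → trans (cong (lookup standardize) z≡a) σa≡y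
    where
    σ-injective : Injective _≡_ _≡_ (lookup standardize)
    σ-injective {a} {b} eq with <-cmp (f a) (f b)
    ... | tri< lt _ _ = contradiction eq (<⇒≢ (Equivalence.to (standardize-< a b) lt))
    ... | tri≈ _ fa≡fb _ = inj fa≡fb
    ... | tri> _ _ gt = contradiction (sym eq) (<⇒≢ (Equivalence.to (standardize-< b a) gt))

open Standardization using (standardize; standardize-<; standardize-isPermutation)

-- Composing f with the inverse of its standardization sorts it.
sort : ∀ (f : Fin m → Fin n) → Injective _≡_ _≡_ f →
       ∃ λ g → g Preserves _<_ ⟶ _<_ × (∀ i → ∃ λ j → g i ≡ f j)
sort f inj = f ∘ σ⁻¹ , increasing , λ i → σ⁻¹ i , refl
  where
  σ-surjective = proj₂ (standardize-isPermutation f inj)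
  σ⁻¹ = proj₁ ∘ σ-surjective

  increasing : (f ∘ σ⁻¹) Preserves _<_ ⟶ _<_
  increasing {i} {j} i<j = Equivalence.from (standardize-< f (σ⁻¹ i) (σ⁻¹ j))
    (subst₂ _<_ (sym (proj₂ (σ-surjective i) refl)) (sym (proj₂ (σ-surjective j) refl)) i<j)

-- Pattern occurrences

involutive⇒isInvolution : {π : Word n n} → AlgDefs.Involutive _≡_ (lookup π) → IsInvolution π
involutive⇒isInvolution {π = π} inv =
  selfInverse⇒bijective (λ {i} eq → trans (cong (lookup π) (sym eq)) (inv i)) , inv

-- The positions of an occurrence increase strictly, so they inject `k` places into `n`.
short-avoids : (T : Word k k → Set) (π : Word n n) → n ℕ.< k → Avoids T π
short-avoids T π n<k σ _ (ι , inc , _) =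
  contradiction (injective⇒≤ (increasing⇒injective inc)) (ℕ.<⇒≱ n<k)

-- The first place of `σ` takes the letter zero, so by injectivity every later letter is positive;
-- the occurrence carries this comparison over to `π`.
𝓕-occurrence-above : ∀ {σ : Word (suc k) (suc k)} {π : Word n n} ((ι , _) : Contains π σ) → 𝓕 (suc k) σ →
                     ∀ a → lookup π (lookup ι zero) < lookup π (lookup ι (suc a))
𝓕-occurrence-above {σ = σ} (ι , _ , iso) ((inj , _) , σ0≡0) a = Equivalence.from (iso zero (suc a))
  (subst (ℕ._< toℕ (lookup σ (suc a))) (sym (σ0≡0 zero refl))
    (ℕ.n≢0⇒n>0 λ σa≡0 → case inj (toℕ-injective (trans (σ0≡0 zero refl) (sym σa≡0))) of λ ()))

-- Position zero followed by the sorted values of `f` is an increasing choice of positions. Its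
-- first letter in `π` is the smallest, so standardizing the chosen letters gives a pattern in `𝓕`.
above-first⇒contains : (π : Word (suc n) (suc n)) → IsPermutation π → (f : Fin k → Fin (suc n)) →
                       Injective _≡_ _≡_ f → (∀ a → lookup π zero < lookup π (f a)) →
                       ∃ λ σ → 𝓕 (suc k) σ × Contains π σ
above-first⇒contains {n} {k} π (π-inj , _) f inj above with sort f inj
... | g , g-inc , g⊆f =
  σ , (σ-perm , σ-first) , tabulate ι ,
    (λ {a} {b} a<b → subst₂ _<_ (sym (ι-at a)) (sym (ι-at b)) (ι-inc a b a<b)) ,
    λ a b → subst₂ (λ i j → (lookup π i < lookup π j) ⇔ (lookup σ a < lookup σ b))
      (sym (ι-at a)) (sym (ι-at b)) (standardize-< (lookup π ∘ ι) a b)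
  where
  ι : Fin (suc k) → Fin (suc n)
  ι zero    = zero
  ι (suc a) = g a

  ι-at : ∀ a → lookup (tabulate ι) a ≡ ι a
  ι-at = Vec.lookup∘tabulate ι

  g-above : ∀ a → lookup π zero < lookup π (g a)
  g-above a with g⊆f a
  ... | b , eq = subst (λ i → lookup π zero < lookup π i) (sym eq) (above b)

  -- A position whose letter exceeds the first letter cannot be the first position.
  0<g : ∀ a → zero {n} < g a
  0<g a with g a in eq
  ... | zero  = contradiction (subst (λ i → lookup π zero < lookup π i) eq (g-above a)) (ℕ.n≮n _)
  ... | suc _ = s≤s z≤n

  ι-inc : ∀ a b → a < b → ι a < ι b
  ι-inc zero    (suc b) _         = 0<g b
  ι-inc (suc a) (suc b) (s≤s a<b) = g-inc a<b

  σ : Word (suc k) (suc k)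
  σ = standardize (lookup π ∘ ι)

  σ-perm : IsPermutation σ
  σ-perm = standardize-isPermutation (lookup π ∘ ι)
    (λ eq → increasing⇒injective (λ {a} {b} → ι-inc a b) (π-inj eq))

  -- Were the letter `zero` at a later place, the first letter of `σ` would lie strictly below it.
  σ0≡0 : lookup σ zero ≡ zero
  σ0≡0 with proj₂ σ-perm zero
  ... | zero  , σ0≡0 = σ0≡0 refl
  ... | suc a , σa≡0 = contradiction
    (subst (lookup σ zero <_) (σa≡0 refl) (Equivalence.to (standardize-< (lookup π ∘ ι) zero (suc a)) (g-above a)))
    λ ()

  σ-first : ∀ i → toℕ i ≡ 0 → toℕ (lookup σ i) ≡ 0
  σ-first zero _ = cong toℕ σ0≡0

-- The positions of the k largest letters witness an occurrence.
avoids⇒first-large : (π : Word (suc n) (suc n)) → IsInvolution π → Avoids (𝓕 (suc k)) π →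
                     ¬ k ≤ n ∸ toℕ (lookup π zero)
avoids⇒first-large {n} {k} π (perm@(π-inj , _) , inv) avoids k≤ =
  let σ , σ∈𝓕 , occ = above-first⇒contains π perm (lookup π ∘ top) (top-injective ∘ π-inj) above
  in avoids σ σ∈𝓕 occ
  where
  k≤1+n : k ≤ suc n
  k≤1+n = ℕ.≤-trans k≤ (ℕ.≤-trans (ℕ.m∸n≤m n (toℕ (lookup π zero))) (ℕ.n≤1+n n))

  top : Fin k → Fin (suc n)
  top a = opposite (inject≤ a k≤1+n)

  top-injective : Injective _≡_ _≡_ top
  top-injective {a} {b} eq = inject≤-injective k≤1+n k≤1+n a b (opposite-injective eq)

  -- Since `π` is an involution, the letter at position `lookup π (top a)` is `top a`, that is
  -- `n ∸ a`. It exceeds the first letter because `a < k` and `k` is at most `n` minus that letter.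
  above : ∀ a → lookup π zero < lookup π (lookup π (top a))
  above a = subst₂ ℕ._<_ (ℕ.m∸[m∸n]≡n (ℕ.s≤s⁻¹ (toℕ<n (lookup π zero))))
    (sym (trans (cong toℕ (inv (top a)))
      (trans (opposite-prop (inject≤ a k≤1+n)) (cong (n ∸_) (toℕ-inject≤ a k≤1+n)))))
    (ℕ.∸-monoʳ-< {n} (ℕ.<-≤-trans (toℕ<n a) k≤) (ℕ.m∸n≤m n (toℕ (lookup π zero))))

-- Insertion of a 2-cycle through the first position

-- Renumbers old positions and old letters alike, leaving free exactly `zero` and `suc v`, the two
-- ends of the new cycle.
embed : Fin (suc m) → Fin m → Fin (suc (suc m))
embed v j = suc (punchIn v j)

-- Index `v` of the tail is position `suc v` of the whole word, so placing `zero` there closes the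
-- cycle opened by the first letter `suc v`.
insert : Fin (suc m) → Word m m → Word (suc (suc m)) (suc (suc m))
insert v w = suc v Vec.∷ insertAt (Vec.map (embed v) w) v zero

lookup-insert-partner : ∀ v (w : Word m m) → lookup (insert v w) (suc v) ≡ zero
lookup-insert-partner v w = Vec.insertAt-lookup (Vec.map (embed v) w) v zero

lookup-insert-embed : ∀ v (w : Word m m) j → lookup (insert v w) (embed v j) ≡ embed v (lookup w j)
lookup-insert-embed v w j =
  trans (Vec.insertAt-punchIn (Vec.map (embed v) w) v zero j) (Vec.lookup-map j (embed v) w)

embed-injective : ∀ (v : Fin (suc m)) {i j} → embed v i ≡ embed v j → i ≡ j
embed-injective v {i} {j} eq = punchIn-injective v i j (suc-injective eq)

embed-mono-< : ∀ (v : Fin (suc m)) {i j} → i < j → embed v i < embed v j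
embed-mono-< v {i} {j} i<j = s≤s (ℕ.≰⇒> λ ≤ → ℕ.<⇒≱ i<j (punchIn-cancel-≤ v j i ≤))

embed-cancel-< : ∀ (v : Fin (suc m)) {i j} → embed v i < embed v j → i < j
embed-cancel-< v {i} {j} lt = ℕ.≰⇒> λ j≤i → ℕ.<⇒≱ (ℕ.s<s⁻¹ lt) (punchIn-mono-≤ v j i j≤i)

embed≢partner : ∀ (v : Fin (suc m)) j → embed v j ≢ suc v
embed≢partner v j eq = punchInᵢ≢i v j (suc-injective eq)

embed-covers : ∀ (v : Fin (suc m)) {i} → i ≢ zero → i ≢ suc v → ∃ λ j → i ≡ embed v j
embed-covers v {zero}  i≢0 _   = contradiction refl i≢0
embed-covers v {suc i} _   i≢v = punchOut v≢i , cong suc (sym (punchIn-punchOut v≢i))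
  where
  v≢i : v ≢ i
  v≢i v≡i = i≢v (cong suc (sym v≡i))

-- A view of positions: matching on `position v i` replaces `i` by one end of the cycle or by the
-- image of an old position.
data Position (v : Fin (suc m)) : Fin (suc (suc m)) → Set where
  first    : Position v zero
  partner  : Position v (suc v)
  embedded : ∀ j → Position v (embed v j)

position : ∀ (v : Fin (suc m)) i → Position v i
position v i with i ≟ zero | i ≟ suc v
... | yes refl | _        = first
... | no _     | yes refl = partner
... | no i≢0   | no i≢v with embed-covers v i≢0 i≢v
...   | j , refl = embedded j

-- The first letter reveals `v`; the letters at embedded positions then reveal `w`, because
-- `embed v` is injective.
insert-injective : ∀ {v v′ : Fin (suc m)} {w w′ : Word m m} → insert v w ≡ insert v′ w′ → v ≡ v′ × w ≡ w′
insert-injective {v = v} {w = w} {w′} eq with suc-injective (cong Vec.head eq)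
... | refl = refl , lookup-ext λ j → embed-injective v
  (trans (sym (lookup-insert-embed v w j))
    (trans (cong (λ π → lookup π (embed v j)) eq) (lookup-insert-embed v w′ j)))

insert-involutive : ∀ v {w : Word m m} → AlgDefs.Involutive _≡_ (lookup w) →
                    AlgDefs.Involutive _≡_ (lookup (insert v w))
insert-involutive v {w} inv i with position v i
... | first      = lookup-insert-partner v w
... | partner    = cong (lookup (insert v w)) (lookup-insert-partner v w)
... | embedded j = trans (cong (lookup (insert v w)) (lookup-insert-embed v w j))
  (trans (lookup-insert-embed v w (lookup w j)) (cong (embed v) (inv j)))

insert-involutive⁻ : ∀ v {w : Word m m} → AlgDefs.Involutive _≡_ (lookup (insert v w)) →
                     AlgDefs.Involutive _≡_ (lookup w)
insert-involutive⁻ v {w} inv j = embed-injective v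
  (trans (sym (lookup-insert-embed v w (lookup w j)))
    (trans (cong (lookup (insert v w)) (sym (lookup-insert-embed v w j))) (inv (embed v j))))

-- An involution that swaps `zero` and `suc v` maps the remaining positions among themselves, and
-- its restriction to them, renumbered, is `w`.
involution-insert : ∀ (π : Word (suc (suc m)) (suc (suc m))) → AlgDefs.Involutive _≡_ (lookup π) →
                    ∀ v → lookup π zero ≡ suc v → ∃ λ w → π ≡ insert v w
involution-insert {m} π inv v π0≡v = w , lookup-ext π≗insert
  where
  πv≡0 : lookup π (suc v) ≡ zero
  πv≡0 = trans (cong (lookup π) (sym π0≡v)) (inv zero)

  preimage : ∀ {i y} → lookup π i ≡ y → i ≡ lookup π y
  preimage {i} eq = trans (sym (inv i)) (cong (lookup π) eq)

  -- If an end of the cycle were the letter at `embed v j`, applying `π` again would make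
  -- `embed v j` the other end.
  image : ∀ j → ∃ λ l → lookup π (embed v j) ≡ embed v l
  image j = embed-covers v
    (λ eq → embed≢partner v j (trans (preimage eq) π0≡v))
    (λ eq → case trans (preimage eq) πv≡0 of λ ())

  w : Word m m
  w = tabulate (proj₁ ∘ image)

  π≗insert : ∀ i → lookup π i ≡ lookup (insert v w) i
  π≗insert i with position v i
  ... | first      = π0≡v
  ... | partner    = trans πv≡0 (sym (lookup-insert-partner v w))
  ... | embedded j = trans (proj₂ (image j))
    (trans (cong (embed v) (sym (Vec.lookup∘tabulate _ j))) (sym (lookup-insert-embed v w j)))

module _ (v : Fin (suc m)) (w : Word m m) (σ : Word k k) where

  private
    π = insert v w

  -- `embed v` preserves and reflects order on letters. Keeping `ι` a function with a pointwise
  -- equation lets both transfers of occurrences below use this.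
  occurrence-embed : ∀ (ι : Fin k → Fin (suc (suc m))) (ι′ : Word k m) → (∀ a → ι a ≡ embed v (lookup ι′ a)) →
                     ∀ a b → (lookup π (ι a) < lookup π (ι b)) ⇔ (lookup w (lookup ι′ a) < lookup w (lookup ι′ b))
  occurrence-embed ι ι′ ι≗ a b = mk⇔
    (embed-cancel-< v ∘ subst₂ _<_ (at a) (at b))
    (subst₂ _<_ (sym (at a)) (sym (at b)) ∘ embed-mono-< v)
    where
    at : ∀ a → lookup π (ι a) ≡ embed v (lookup w (lookup ι′ a))
    at a = trans (cong (lookup π) (ι≗ a)) (lookup-insert-embed v w (lookup ι′ a))

  contains-insert : Contains w σ → Contains π σ
  contains-insert (ι′ , inc , iso) = Vec.map (embed v) ι′ ,
    (λ {a} {b} a<b → subst₂ _<_ (sym (ι≗ a)) (sym (ι≗ b)) (embed-mono-< v (inc a<b))) ,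
    λ a b → iso a b ⇔-∘ occurrence-embed (lookup (Vec.map (embed v) ι′)) ι′ ι≗ a b
    where
    ι≗ : ∀ a → lookup (Vec.map (embed v) ι′) a ≡ embed v (lookup ι′ a)
    ι≗ a = Vec.lookup-map a (embed v) ι′

  -- Positions avoiding both ends of the cycle all lie in the image of `embed v`, so the occurrence
  -- can be pulled back.
  contains-insert⁻ : ((ι , _) : Contains π σ) → (∀ a → lookup ι a ≢ zero) → (∀ a → lookup ι a ≢ suc v) →
                     Contains w σ
  contains-insert⁻ (ι , inc , iso) ι≢0 ι≢v = ι′ ,
    (λ {a} {b} a<b → embed-cancel-< v (subst₂ _<_ (ι≗ a) (ι≗ b) (inc a<b))) ,
    λ a b → iso a b ⇔-∘ ⇔-sym (occurrence-embed (lookup ι) ι′ ι≗ a b)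
    where
    preimage : ∀ a → ∃ λ j → lookup ι a ≡ embed v j
    preimage a = embed-covers v (ι≢0 a) (ι≢v a)

    ι′ : Word k m
    ι′ = tabulate (proj₁ ∘ preimage)

    ι≗ : ∀ a → lookup ι a ≡ embed v (lookup ι′ a)
    ι≗ a = trans (proj₂ (preimage a)) (cong (embed v) (sym (Vec.lookup∘tabulate _ a)))

-- At most m ∸ v letters exceed the first letter, and at most m ∸ v positions
-- lie to the right of the smallest letter, so neither end of the inserted
-- cycle starts an occurrence.  Nor can they come later in one: the first end
-- has nothing to its left, the other has nothing smaller than its letter.
insert-avoids : ∀ v {w : Word m m} → IsInvolution w → m ∸ toℕ v ℕ.< k → Avoids (𝓕 (suc k)) w →
                Avoids (𝓕 (suc k)) (insert v w)
insert-avoids {m} {k} v {w} (_ , inv) v-large avoids σ σ∈𝓕 occ@(ι , inc , _) =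
  avoids σ σ∈𝓕 (contains-insert⁻ v w σ occ ι≢0 ι≢v)
  where
  π = insert v w

  π-injective : Injective _≡_ _≡_ (lookup π)
  π-injective = proj₁ (proj₁ (involutive⇒isInvolution {π = π} (insert-involutive v {w} inv)))

  ι-injective : Injective _≡_ _≡_ (lookup ι)
  ι-injective = increasing⇒injective inc

  above : ∀ a → lookup π (lookup ι zero) < lookup π (lookup ι (suc a))
  above = 𝓕-occurrence-above {σ = σ} {π = π} occ σ∈𝓕

  ι0≢0 : lookup ι zero ≢ zero
  ι0≢0 eq = ℕ.<⇒≱ v-large (injective-above⇒≤ {f = λ a → lookup π (lookup ι (suc a))}
    (suc-injective ∘ ι-injective ∘ π-injective)
    λ a → subst (λ i → lookup π i < lookup π (lookup ι (suc a))) eq (above a))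

  ι0≢v : lookup ι zero ≢ suc v
  ι0≢v eq = ℕ.<⇒≱ v-large (injective-above⇒≤ {f = λ a → lookup ι (suc a)}
    (suc-injective ∘ ι-injective)
    λ a → subst (_< lookup ι (suc a)) eq (inc (s≤s z≤n)))

  ι≢0 : ∀ a → lookup ι a ≢ zero
  ι≢0 zero    = ι0≢0
  ι≢0 (suc a) eq = case subst (lookup ι zero <_) eq (inc (s≤s z≤n)) of λ ()

  ι≢v : ∀ a → lookup ι a ≢ suc v
  ι≢v zero    = ι0≢v
  ι≢v (suc a) eq = case subst (lookup π (lookup ι zero) <_)
    (trans (cong (lookup π) eq) (lookup-insert-partner v w)) (above a) of λ ()

-- The first letter has fewer than `k` letters above it. This keeps it from being a fixed point and
-- bounds `v`, and any forbidden occurrence in the remaining word would persist in `π`.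
avoids⇒insert : k ≤ suc m → (π : Word (suc (suc m)) (suc (suc m))) → IsInvolution π → Avoids (𝓕 (suc k)) π →
                ∃₂ λ v w → m ∸ toℕ v ℕ.< k × (IsInvolution w × Avoids (𝓕 (suc k)) w) × π ≡ insert v w
avoids⇒insert {k} {m} k≤1+m π isInv@(_ , inv) avoids = remove (lookup π zero) refl
  where
  remove : ∀ i → lookup π zero ≡ i →
           ∃₂ λ v w → m ∸ toℕ v ℕ.< k × (IsInvolution w × Avoids (𝓕 (suc k)) w) × π ≡ insert v w
  -- Were the first position fixed, all `suc m` other letters would exceed its letter, and these are
  -- at least `k`.
  remove zero    π0≡0 = contradiction
    (subst (λ i → k ≤ suc m ∸ toℕ i) (sym π0≡0) k≤1+m) (avoids⇒first-large π isInv avoids)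
  remove (suc v) π0≡v =
    let w , π≡ = involution-insert π inv v π0≡v
    in v , w ,
       ℕ.≰⇒> (λ k≤ → avoids⇒first-large π isInv avoids (subst (λ i → k ≤ suc m ∸ toℕ i) (sym π0≡v) k≤)) ,
       (involutive⇒isInvolution {π = w} (insert-involutive⁻ v {w} (subst (AlgDefs.Involutive _≡_ ∘ lookup) π≡ inv)) ,
        λ σ σ∈𝓕 occ → subst (Avoids (𝓕 (suc k))) π≡ avoids σ σ∈𝓕 (contains-insert v w σ occ)) ,
       π≡

-- Counting by the 2-cycle through the first position

-- Without repetitions, having the same members means having the same multiplicities. This reduces
-- counting bijections to membership in both directions.
unique-set⇒↭ : ∀ {A : Set} {xs ys : List A} → Unique xs → Unique ys →
               (∀ {z} → z List.∈ xs → z List.∈ ys) → (∀ {z} → z List.∈ ys → z List.∈ xs) → xs ↭ ys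
unique-set⇒↭ u v to from = ∼bag⇒↭ (unique∧set⇒bag u v (mk⇔ to from))

-- Both ends of the cycle are moved, and an embedded position is fixed exactly when the old one was.
fix-insert : ∀ v (w : Word m m) → fix (insert v w) ≡ fix w
fix-insert {m} v w = trans
  (↭-length (unique-set⇒↭ (Unique.filter⁺ π-fixes? (Unique.allFin⁺ _))
    (Unique.map⁺ (embed-injective v) (Unique.filter⁺ fixes? (Unique.allFin⁺ m))) to from))
  (List.length-map (embed v) (filter fixes? (allFin m)))
  where
  π = insert v w

  π-fixes? : Decidable (λ i → lookup π i ≡ i)
  π-fixes? i = lookup π i ≟ i

  fixes? : Decidable (λ j → lookup w j ≡ j)
  fixes? j = lookup w j ≟ j

  to : ∀ {i} → i List.∈ filter π-fixes? (allFin _) → i List.∈ List.map (embed v) (filter fixes? (allFin m))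
  to {i} i∈ with position v i | proj₂ (List.∈-filter⁻ π-fixes? {xs = allFin _} i∈)
  ... | first      | ()
  ... | partner    | eq = case trans (sym (lookup-insert-partner v w)) eq of λ ()
  ... | embedded j | eq = List.∈-map⁺ (embed v) (List.∈-filter⁺ fixes? (List.∈-allFin j)
    (embed-injective v (trans (sym (lookup-insert-embed v w j)) eq)))

  from : ∀ {i} → i List.∈ List.map (embed v) (filter fixes? (allFin m)) → i List.∈ filter π-fixes? (allFin _)
  from i∈ with List.∈-map⁻ (embed v) i∈
  ... | j , j∈ , refl = List.∈-filter⁺ π-fixes? (List.∈-allFin (embed v j))
    (trans (lookup-insert-embed v w j) (cong (embed v) (proj₂ (List.∈-filter⁻ fixes? {xs = allFin m} j∈))))

record Enumerates {A : Set} (P : A → Set) (xs : List A) : Set where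
  field
    unique   : Unique xs
    sound    : ∀ {z} → z List.∈ xs → P z
    complete : ∀ {z} → P z → z List.∈ xs

open Enumerates

Avoider : ∀ k n → Word n n → Set
Avoider k n π = IsInvolution π × Avoids (𝓕 k) π

involutionsAvoiding-enumerates : ∀ k n → Enumerates (Avoider k n) (involutionsAvoiding (𝓕? k) n)
involutionsAvoiding-enumerates k n = record
  { unique   = Unique.filter⁺ (avoids? (𝓕? k)) (Unique.filter⁺ isInvolution? (words-unique n n))
  ; sound    = λ π∈ →
      let π∈inv , av = List.∈-filter⁻ (avoids? (𝓕? k)) {xs = involutions n} π∈
      in proj₂ (List.∈-filter⁻ isInvolution? {xs = words n n} π∈inv) , av
  ; complete = λ {π} (inv , av) →
      List.∈-filter⁺ (avoids? (𝓕? k)) (List.∈-filter⁺ isInvolution? (∈-words π) inv) av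
  }

module _ (k≤1+m : k ≤ suc m) where

  -- The values `m`, `m - 1` and so on, `k` of them, counted down from the top; `k≤1+m` ensures that
  -- there are enough.
  partners : List (Fin (suc m))
  partners = List.map (λ i → opposite (inject≤ i k≤1+m)) (allFin k)

  length-partners : length partners ≡ k
  length-partners = trans (List.length-map _ (allFin k)) (List.length-tabulate (λ i → i))

  partners-unique : Unique partners
  partners-unique = Unique.map⁺
    (λ {i} {j} eq → inject≤-injective k≤1+m k≤1+m i j (opposite-injective eq))
    (Unique.allFin⁺ k)

  -- The index of `v` in the countdown is `m ∸ toℕ v`, which `opposite` sends back to `v`.
  ∈-partners⁺ : ∀ {v} → m ∸ toℕ v ℕ.< k → v List.∈ partners
  ∈-partners⁺ {v} v-large = subst (List._∈ partners)
    (trans (cong opposite (toℕ-injective (trans (toℕ-inject≤ _ k≤1+m)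
             (trans (toℕ-fromℕ< v-large) (sym (opposite-prop v))))))
           (opposite-involutive v))
    (List.∈-map⁺ _ (List.∈-allFin (fromℕ< v-large)))

  ∈-partners⁻ : ∀ {v} → v List.∈ partners → m ∸ toℕ v ℕ.< k
  ∈-partners⁻ v∈ with List.∈-map⁻ _ v∈
  ... | i , _ , refl = subst (ℕ._< k)
    (sym (trans (sym (opposite-prop (opposite (inject≤ i k≤1+m))))
           (trans (cong toℕ (opposite-involutive (inject≤ i k≤1+m))) (toℕ-inject≤ i k≤1+m))))
    (toℕ<n i)

  -- Removing the first cycle and inserting one give the two inclusions. Working with arbitrary
  -- enumerations leaves only membership to check.
  enumerates-insert-↭ : ∀ {xs ys} → Enumerates (Avoider (suc k) (suc (suc m))) xs →
                        Enumerates (Avoider (suc k) m) ys → xs ↭ cartesianProductWith insert partners ys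
  enumerates-insert-↭ {xs} {ys} xs-enum ys-enum = unique-set⇒↭ (unique xs-enum)
    (Unique.cartesianProductWith⁺ insert insert-injective partners-unique (unique ys-enum))
    to from
    where
    to : ∀ {π} → π List.∈ xs → π List.∈ cartesianProductWith insert partners ys
    to {π} π∈ with sound xs-enum π∈
    ... | isInv , avoids with avoids⇒insert k≤1+m π isInv avoids
    ...   | v , w , v-large , w-good , refl =
      List.∈-cartesianProductWith⁺ insert (∈-partners⁺ v-large) (complete ys-enum w-good)

    from : ∀ {π} → π List.∈ cartesianProductWith insert partners ys → π List.∈ xs
    from π∈ with List.∈-cartesianProductWith⁻ insert partners ys π∈
    ... | v , w , v∈ , w∈ , refl with sound ys-enum w∈
    ...   | isInv@(_ , inv) , avoids = complete xs-enum
      (involutive⇒isInvolution {π = insert v w} (insert-involutive v {w} inv) ,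
       insert-avoids v isInv (∈-partners⁻ v∈) avoids)

  involutionsAvoiding-↭ : involutionsAvoiding (𝓕? (suc k)) (suc (suc m)) ↭
                          cartesianProductWith insert partners (involutionsAvoiding (𝓕? (suc k)) m)
  involutionsAvoiding-↭ = enumerates-insert-↭
    (involutionsAvoiding-enumerates (suc k) (suc (suc m))) (involutionsAvoiding-enumerates (suc k) m)

involutionsAvoiding-short : n ℕ.< k → involutionsAvoiding (𝓕? k) n ≡ involutions n
involutionsAvoiding-short {n} {k} n<k = List.filter-all (avoids? (𝓕? k))
  (All.tabulate λ {π} _ → short-avoids (𝓕 k) π n<k)

length-cartesianProductWith : ∀ {A B C : Set} (f : A → B → C) xs ys →
                              length (cartesianProductWith f xs ys) ≡ length xs * length ys
length-cartesianProductWith f []       ys = refl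
length-cartesianProductWith f (x ∷ xs) ys = trans (List.length-++ (List.map (f x) ys))
  (cong₂ _+_ (List.length-map (f x) ys) (length-cartesianProductWith f xs ys))

length-involutionsAvoiding : k ≤ suc m → length (involutionsAvoiding (𝓕? (suc k)) (suc (suc m))) ≡
                                         k * length (involutionsAvoiding (𝓕? (suc k)) m)
length-involutionsAvoiding {k} {m} k≤1+m = trans (↭-length (involutionsAvoiding-↭ k≤1+m))
  (trans (length-cartesianProductWith insert (partners k≤1+m) (involutionsAvoiding (𝓕? (suc k)) m))
    (cong (_* length (involutionsAvoiding (𝓕? (suc k)) m)) (length-partners k≤1+m)))

-- Weighted counts and power series

module _ {c ℓ} (R : CommutativeRing c ℓ) where

  open CommutativeRing R
    using (Carrier; -_; 0#; 1#; reflexive; setoid; semiring; ring; +-monoid; +-cong; +-congˡ; +-congʳ; +-assoc;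
           +-comm; +-identityˡ; +-identityʳ; -‿inverseʳ; *-congˡ; *-congʳ; *-assoc; *-comm; *-identityˡ;
           *-identityʳ; distribˡ; distribʳ)
    renaming (_≈_ to infix 4 _≈′_; _+_ to infixl 6 _✚_; _*_ to infixl 7 _✱_; _-_ to infixl 6 _━_;
              refl to ≈-refl; sym to ≈-sym; trans to ≈-trans)
  open RawSemiringDefs (Semiring.rawSemiring semiring) using ()
    renaming (_×_ to infixr 8 _×′_; _^_ to infixr 9 _^′_; sum to ∑)
  open MonoidMult +-monoid using (×-congʳ)
  open SemiringMult semiring using (×-comm-*; ×-assoc-*)
  open SemiringSum semiring using (*-distribˡ-sum; sum-cong-≋)
  open RingProperties ring using (-‿distribˡ-*)
  open import Relation.Binary.Reasoning.Setoid setoid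

  module _ {A : Set} (weight : A → Carrier) where

    -- `fixEnumerator` is the instance whose weight is `p` to the power `fix π`.
    total : List A → Carrier
    total = List.foldr (λ a s → weight a ✚ s) 0#

    total-++ : ∀ xs ys → total (xs ++ ys) ≈′ total xs ✚ total ys
    total-++ []       ys = ≈-sym (+-identityˡ _)
    total-++ (a ∷ xs) ys = ≈-trans (+-congˡ (total-++ xs ys)) (≈-sym (+-assoc _ _ _))

    total-↭ : ∀ {xs ys} → xs ↭ ys → total xs ≈′ total ys
    total-↭ ↭.refl          = ≈-refl
    total-↭ (↭.prep a eq)   = +-congˡ (total-↭ eq)
    total-↭ (↭.swap a b eq) = ≈-trans (≈-sym (+-assoc _ _ _))
      (≈-trans (+-cong (+-comm _ _) (total-↭ eq)) (+-assoc _ _ _))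
    total-↭ (↭.trans eq eq′) = ≈-trans (total-↭ eq) (total-↭ eq′)

  total-map : ∀ {A B : Set} {weightA : A → Carrier} {weightB : B → Carrier} {f : A → B} →
              (∀ a → weightB (f a) ≡ weightA a) → ∀ xs → total weightB (List.map f xs) ≡ total weightA xs
  total-map f-weight []       = refl
  total-map f-weight (a ∷ xs) = cong₂ _✚_ (f-weight a) (total-map f-weight xs)

  -- The weight ignores the first factor, so each entry of `xs` contributes one copy of the total
  -- over `ys`.
  total-cartesianProductWith : ∀ {A B C : Set} {weightB : B → Carrier} {weightC : C → Carrier} {f : A → B → C} →
                               (∀ a b → weightC (f a b) ≡ weightB b) → ∀ xs ys →
                               total weightC (cartesianProductWith f xs ys) ≈′ length xs ×′ total weightB ys
  total-cartesianProductWith f-weight []       ys = ≈-refl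
  total-cartesianProductWith {weightC = weightC} {f} f-weight (a ∷ xs) ys = ≈-trans
    (total-++ weightC (List.map (f a) ys) _)
    (+-cong (reflexive (total-map (f-weight a) ys)) (total-cartesianProductWith f-weight xs ys))

  -- The inductive step of `truncation`: multiplication by `X` raises every power in the expansion
  -- of the tail `g` by one and makes room for the constant term of `f`.
  truncation-step : ∀ X (c : Fin (suc n) → Carrier) {f g y h} → f ≈′ c zero ✚ X ✱ g →
                    g ≈′ ∑ {n} (λ j → c (suc j) ✱ X ^′ toℕ j) ✚ y ✱ h →
                    f ≈′ ∑ {suc n} (λ j → c j ✱ X ^′ toℕ j) ✚ X ✱ y ✱ h
  truncation-step {n} X c {f} {g} {y} {h} f≈ g≈ = begin
    f
      ≈⟨ f≈ ⟩
    c zero ✚ X ✱ g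
      ≈⟨ +-cong (≈-sym (*-identityʳ _)) (*-congˡ g≈) ⟩
    c zero ✱ 1# ✚ X ✱ (∑ {n} (λ j → c (suc j) ✱ X ^′ toℕ j) ✚ y ✱ h)
      ≈⟨ +-congˡ (distribˡ _ _ _) ⟩
    c zero ✱ 1# ✚ (X ✱ ∑ {n} (λ j → c (suc j) ✱ X ^′ toℕ j) ✚ X ✱ (y ✱ h))
      ≈⟨ +-assoc _ _ _ ⟨
    c zero ✱ 1# ✚ X ✱ ∑ {n} (λ j → c (suc j) ✱ X ^′ toℕ j) ✚ X ✱ (y ✱ h)
      ≈⟨ +-cong (+-congˡ shift) (≈-sym (*-assoc X y h)) ⟩
    c zero ✱ 1# ✚ ∑ {n} (λ j → c (suc j) ✱ X ^′ suc (toℕ j)) ✚ X ✱ y ✱ h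
      ∎
    where
    shift : X ✱ ∑ {n} (λ j → c (suc j) ✱ X ^′ toℕ j) ≈′ ∑ {n} (λ j → c (suc j) ✱ X ^′ suc (toℕ j))
    shift = ≈-trans (*-distribˡ-sum {n} X _) (sum-cong-≋ {n} λ j → ≈-trans (≈-sym (*-assoc _ _ _))
      (≈-trans (*-congʳ (*-comm _ _)) (*-assoc _ _ _)))

  -- Substituting both recurrence equations gives `g ≈′ N ✚ q ✱ g`, so `(1# ━ q) ✱ g ≈′ N`, and
  -- multiplying by the inverse `r` isolates `g`.
  recurrence-solution : ∀ m {X r g t b c₀ c₁} → (1# ━ m ×′ X ^′ 2) ✱ r ≈′ 1# →
                        g ≈′ c₀ ✚ X ✱ (c₁ ✚ X ✱ t) → c₁ ≈′ m ×′ b → t ≈′ m ×′ g →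
                        g ≈′ r ✱ (m ×′ b ✱ X ✚ c₀)
  recurrence-solution m {X} {r} {g} {t} {b} {c₀} {c₁} dr≈1 g≈ c₁≈ t≈ = begin
    g                     ≈⟨ *-identityˡ g ⟨
    1# ✱ g                ≈⟨ *-congʳ dr≈1 ⟨
    (1# ━ q) ✱ r ✱ g      ≈⟨ *-congʳ (*-comm _ _) ⟩
    r ✱ (1# ━ q) ✱ g      ≈⟨ *-assoc _ _ _ ⟩
    r ✱ ((1# ━ q) ✱ g)    ≈⟨ *-congˡ numerator ⟩
    r ✱ (m ×′ b ✱ X ✚ c₀) ∎
    where
    q N : Carrier
    q = m ×′ X ^′ 2
    N = m ×′ b ✱ X ✚ c₀

    quadratic : X ✱ (X ✱ (m ×′ g)) ≈′ q ✱ g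
    quadratic = begin
      X ✱ (X ✱ (m ×′ g))   ≈⟨ *-assoc _ _ _ ⟨
      X ✱ X ✱ (m ×′ g)     ≈⟨ ×-comm-* m _ _ ⟩
      m ×′ (X ✱ X ✱ g)     ≈⟨ ×-assoc-* m _ _ ⟨
      -- `X ^′ 2` unfolds to `X ✱ (X ✱ 1#)`, hence the extra unit.
      m ×′ (X ✱ X) ✱ g     ≈⟨ *-congʳ (×-congʳ m (*-congˡ (≈-sym (*-identityʳ X)))) ⟩
      q ✱ g                ∎

    unrolled : g ≈′ N ✚ q ✱ g
    unrolled = begin
      g                                                ≈⟨ g≈ ⟩
      c₀ ✚ X ✱ (c₁ ✚ X ✱ t)                            ≈⟨ +-congˡ (*-congˡ (+-cong c₁≈ (*-congˡ t≈))) ⟩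
      c₀ ✚ X ✱ (m ×′ b ✚ X ✱ (m ×′ g))                 ≈⟨ +-congˡ (distribˡ _ _ _) ⟩
      c₀ ✚ (X ✱ (m ×′ b) ✚ X ✱ (X ✱ (m ×′ g)))         ≈⟨ +-assoc _ _ _ ⟨
      c₀ ✚ X ✱ (m ×′ b) ✚ X ✱ (X ✱ (m ×′ g))           ≈⟨ +-cong (≈-trans (+-comm _ _) (+-congʳ (*-comm _ _))) quadratic ⟩
      N ✚ q ✱ g                                        ∎

    numerator : (1# ━ q) ✱ g ≈′ N
    numerator = begin
      (1# ━ q) ✱ g             ≈⟨ distribʳ _ _ _ ⟩
      1# ✱ g ✚ (- q) ✱ g       ≈⟨ +-cong (≈-trans (*-identityˡ g) unrolled) (≈-sym (-‿distribˡ-* q g)) ⟩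
      N ✚ q ✱ g ━ q ✱ g        ≈⟨ +-assoc _ _ _ ⟩
      N ✚ (q ✱ g ━ q ✱ g)      ≈⟨ +-congˡ (-‿inverseʳ _) ⟩
      N ✚ 0#                   ≈⟨ +-identityʳ N ⟩
      N                        ∎

  closed-form : ∀ {f s s′ y g r N} → f ≈′ s ✚ y ✱ g → s ≈′ s′ → g ≈′ r ✱ N → f ≈′ s′ ✚ y ✱ r ✱ N
  closed-form f≈ s≈ g≈ = ≈-trans f≈ (+-cong s≈ (≈-trans (*-congˡ g≈) (≈-sym (*-assoc _ _ _))))

-- Splitting off initial coefficients of a power series

module Truncation {c ℓ} (R : CommutativeRing c ℓ) where

  open CommutativeRing R
    using (0#; 1#; +-congˡ; +-cong; +-identityˡ; +-identityʳ; zeroˡ; reflexive; setoid)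
    renaming (_≈_ to infix 4 _≈′_; _+_ to infixl 6 _✚_; _*_ to infixl 7 _✱_;
              refl to ≈-refl; sym to ≈-sym; trans to ≈-trans)
  open PowerSeries R using (X; powerSeriesRing; recip-1-mX²) renaming (constant to const; recip to inverse)
  private
    module S = CommutativeRing powerSeriesRing
    module S^ = RawSemiringDefs (Semiring.rawSemiring S.semiring)
    module R^ = RawSemiringDefs (Semiring.rawSemiring (CommutativeRing.semiring R))
  open import Relation.Binary.Reasoning.Setoid setoid

  X*-suc : ∀ f n → (X S.* f) (suc n) ≈′ f n
  X*-suc f n = begin
    0# ✱ f (suc n) ✚ ((X ∘ suc) S.* f) n ≈⟨ +-cong (zeroˡ _) (S.*-congʳ {f} {X ∘ suc} {const 1#} tail-X n) ⟩
    0# ✚ (const 1# S.* f) n              ≈⟨ +-identityˡ _ ⟩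
    (const 1# S.* f) n                   ≈⟨ S.*-identityˡ f n ⟩
    f n                                  ∎
    where
    tail-X : (X ∘ suc) S.≈ const 1#
    tail-X zero    = ≈-refl
    tail-X (suc _) = ≈-refl

  head-tail : ∀ f → f S.≈ const (f 0) S.+ X S.* (f ∘ suc)
  head-tail f zero    = ≈-sym (≈-trans (+-congˡ (≈-trans (+-identityʳ _) (zeroˡ _))) (+-identityʳ _))
  head-tail f (suc n) = ≈-sym (≈-trans (+-identityˡ _) (X*-suc (f ∘ suc) n))

  truncation : ∀ n f → f S.≈ S^.sum {n} (λ j → const (f (toℕ j)) S.* X S^.^ toℕ j) S.+ X S^.^ n S.* (λ i → f (n + i))
  truncation zero    f i = ≈-sym (≈-trans (+-identityˡ _) (S.*-identityˡ f i))
  truncation (suc n) f   = truncation-step powerSeriesRing {n} X (λ j → const (f (toℕ j)))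
    {f} {f ∘ suc} {X S^.^ n} {λ i → f (suc n + i)} (head-tail f) (truncation n (f ∘ suc))

  ×-coefficient : ∀ m f n → (m S^.× f) n ≡ m R^.× f n
  ×-coefficient zero    f n = refl
  ×-coefficient (suc m) f n = cong (f n ✚_) (×-coefficient m f n)

  ×-const : ∀ m a → const (m R^.× a) S.≈ m S^.× const a
  ×-const m a zero    = reflexive (sym (×-coefficient m (const a) zero))
  ×-const m a (suc n) = ≈-trans (×0 m) (reflexive (sym (×-coefficient m (const a) (suc n))))
    where
    ×0 : ∀ m → 0# ≈′ m R^.× 0#
    ×0 zero    = ≈-refl
    ×0 (suc m) = ≈-trans (×0 m) (≈-sym (+-identityˡ _))

  const-cong : ∀ {a b} → a ≈′ b → const a S.≈ const b
  const-cong a≈b zero    = a≈b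
  const-cong a≈b (suc n) = ≈-refl

  -- Applying `head-tail` twice exposes the shift of `g` by two, which the coefficientwise
  -- recurrence identifies with the `m`-fold sum of `g`.
  two-step-recurrence : ∀ m g b → g 1 ≈′ m R^.× b → (∀ n → g (suc (suc n)) ≈′ m R^.× g n) →
                        g S.≈ inverse (S.1# S.- (m S^.× X S^.^ 2)) S.* (m S^.× const b S.* X S.+ const (g 0))
  two-step-recurrence m g b g1≈ step = recurrence-solution powerSeriesRing m
    {X} {inverse (S.1# S.- (m S^.× X S^.^ 2))} {g} {λ n → g (suc (suc n))} {b = const b} {const (g 0)} {const (g 1)}
    (recip-1-mX² m)
    (S.trans {g} {const (g 0) S.+ X S.* (g ∘ suc)} (head-tail g)
      (S.+-congˡ {const (g 0)} {X S.* (g ∘ suc)} (S.*-congˡ {X} {g ∘ suc} (head-tail (g ∘ suc)))))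
    (λ n → ≈-trans (const-cong g1≈ n) (×-const m b n))
    (λ n → ≈-trans (step n) (reflexive (sym (×-coefficient m g n))))

-- Recurrence and closed form for the fixed-point enumerator

open Truncation ℤ⟦p⟧-ring using (truncation; two-step-recurrence)

private
  module A = CommutativeRing ℤ⟦p⟧-ring
  module A^ = RawSemiringDefs (Semiring.rawSemiring A.semiring)
  module S = CommutativeRing ℤ⟦p⟧⟦x⟧-ring

F-recurrence : k ≤ suc m → F (suc k) (suc (suc m)) A.≈ k A^.× F (suc k) m
F-recurrence {k} {m} k≤1+m = A.trans {F (suc k) (suc (suc m))} {total ℤ⟦p⟧-ring weight product}
  (total-↭ ℤ⟦p⟧-ring weight (involutionsAvoiding-↭ k≤1+m))
  -- The number of copies arises as the length of `partners`, which equals `k` only up to a proof.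
  (subst (λ l → total ℤ⟦p⟧-ring weight product A.≈ l A^.× F (suc k) m) (length-partners k≤1+m)
    (total-cartesianProductWith ℤ⟦p⟧-ring {weightB = weight} {weight} {insert}
      (λ v w → cong (p A^.^_) (fix-insert v w)) (partners k≤1+m) (involutionsAvoiding (𝓕? (suc k)) m)))
  where
  weight : ∀ {n} → Word n n → ℤ⟦p⟧.Series
  weight π = p A^.^ fix π

  product = cartesianProductWith insert (partners k≤1+m) (involutionsAvoiding (𝓕? (suc k)) m)

F-short : ∀ k n → n ℕ.< k → F k n ≡ J n
F-short k n n<k = cong fixEnumerator (involutionsAvoiding-short n<k)

-- With patterns of length `suc (suc k)`, every coefficient of index at most `suc k` is a `J`. The
-- series is cut before index `suc k`, so that the remainder `g` starts with `J (suc k)` and obeys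
-- the two-step recurrence throughout.
F-closed-form : ∀ k → F (suc (suc k)) ≈ sum {suc k} (λ j → constant (J (toℕ j)) ⊛ x ↑ toℕ j)
                        ⊕ x ↑ suc k ⊛ recip (𝟙 ⊖ suc k · x ↑ 2)
                          ⊛ (suc k · constant (J k) ⊛ x ⊕ constant (J (suc k)))
F-closed-form k = closed-form ℤ⟦p⟧⟦x⟧-ring
  {f} {sum {suc k} (λ j → constant (f (toℕ j)) ⊛ x ↑ toℕ j)} {sum {suc k} (λ j → constant (J (toℕ j)) ⊛ x ↑ toℕ j)}
  {x ↑ suc k} {g} {recip (𝟙 ⊖ suc k · x ↑ 2)} {suc k · constant (J k) ⊛ x ⊕ constant (J (suc k))}
  (truncation (suc k) f)
  (sum-cong-≋ {suc k} λ j → S.reflexive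
    (cong (λ a → constant a ⊛ x ↑ toℕ j) (F-short (suc (suc k)) (toℕ j) (ℕ.<-trans (toℕ<n j) ℕ.≤-refl))))
  (subst (λ a → g ≈ recip (𝟙 ⊖ suc k · x ↑ 2) ⊛ (suc k · constant (J k) ⊛ x ⊕ constant a)) g0≡
    (two-step-recurrence (suc k) g (J k) g1≈ g-step))
  where
  open SemiringSum S.semiring using (sum-cong-≋)

  f g : ℤ⟦p⟧⟦x⟧.Series
  f = F (suc (suc k))
  g i = f (suc k + i)

  g0≡ : g 0 ≡ J (suc k)
  g0≡ = trans (cong f (ℕ.+-identityʳ (suc k))) (F-short (suc (suc k)) (suc k) ℕ.≤-refl)

  -- Index `suc (suc k)` is where the recurrence first applies, and it leads back to length `k`, too
  -- short for any pattern.
  g1≈ : g 1 A.≈ suc k A^.× J k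
  g1≈ = subst₂ (λ n a → f n A.≈ suc k A^.× a) (ℕ.+-comm 1 (suc k)) (F-short (suc (suc k)) k (ℕ.n≤1+n (suc k)))
    (F-recurrence {suc k} {k} ℕ.≤-refl)

  g-step : ∀ n → g (suc (suc n)) A.≈ suc k A^.× g n
  g-step n = subst (λ i → f i A.≈ suc k A^.× g n)
    (sym (trans (ℕ.+-suc (suc k) (suc n)) (cong suc (ℕ.+-suc (suc k) n))))
    (F-recurrence {suc k} {suc k + n} (ℕ.≤-trans (ℕ.m≤m+n (suc k) n) (ℕ.n≤1+n (suc k + n))))

-- Numbers of avoiding involutions

iterate-two-step : ∀ (f : ℕ → ℕ) c m → (∀ i → f (suc (suc (m + i))) ≡ c * f (m + i)) →
                   ∀ n → f (m + 2 * n) ≡ c ^ n * f m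
iterate-two-step f c m step zero    = trans (cong f (ℕ.+-identityʳ m)) (sym (ℕ.+-identityʳ (f m)))
iterate-two-step f c m step (suc n) = begin
  f (m + 2 * suc n)            ≡⟨ cong (λ i → f (m + i)) (ℕ.*-suc 2 n) ⟩
  f (m + suc (suc (2 * n)))    ≡⟨ cong f (trans (ℕ.+-suc m _) (cong suc (ℕ.+-suc m _))) ⟩
  f (suc (suc (m + 2 * n)))    ≡⟨ step (2 * n) ⟩
  c * f (m + 2 * n)            ≡⟨ cong (c *_) (iterate-two-step f c m step n) ⟩
  c * (c ^ n * f m)            ≡⟨ ℕ.*-assoc c (c ^ n) (f m) ⟨
  c ^ suc n * f m              ∎
  where open ≡.≡-Reasoning

module _ (k : ℕ) where

  private
    count : ℕ → ℕ
    count n = length (involutionsAvoiding (𝓕? (suc (suc k))) n)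

  -- One step of the recurrence leads to length `k + 2 * n` and `n` more lead to `k`, hence the
  -- exponent `n + 1`.
  count-even : ∀ n → count (suc (suc k) + 2 * n) ≡ suc k ^ (n + 1) * I k
  count-even n = begin
    count (suc (suc (k + 2 * n)))   ≡⟨ length-involutionsAvoiding (s≤s (ℕ.m≤m+n k (2 * n))) ⟩
    suc k * count (k + 2 * n)       ≡⟨ cong (suc k *_) (iterate-two-step count (suc k) k
                                         (λ i → length-involutionsAvoiding (s≤s (ℕ.m≤m+n k i))) n) ⟩
    suc k * (suc k ^ n * count k)   ≡⟨ ℕ.*-assoc (suc k) (suc k ^ n) (count k) ⟨
    suc k ^ suc n * count k         ≡⟨ cong₂ (λ i l → suc k ^ i * l) (ℕ.+-comm 1 n)
                                         (cong length (involutionsAvoiding-short (ℕ.n≤1+n (suc k)))) ⟩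
    suc k ^ (n + 1) * I k           ∎
    where open ≡.≡-Reasoning

  -- Here `n` steps end at length `suc k`, the greatest at which every involution still avoids the
  -- patterns.
  count-odd : ∀ n → count (suc k + 2 * n) ≡ suc k ^ n * I (suc k)
  count-odd n = trans
    (iterate-two-step count (suc k) (suc k)
      (λ i → length-involutionsAvoiding (ℕ.≤-trans (ℕ.m≤m+n (suc k) i) (ℕ.n≤1+n (suc k + i)))) n)
    (cong (λ π → suc k ^ n * length π) (involutionsAvoiding-short {n = suc k} ℕ.≤-refl))

theorem3p1 : (k : ℕ) → 2 ≤ k →
    (F k ≈ sum {k ∸ 1} (λ j → constant (J (toℕ j)) ⊛ x ↑ toℕ j)
    ⊕ x ↑ (k ∸ 1) ⊛ recip (𝟙 ⊖ (k ∸ 1) · x ↑ 2)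
    ⊛ ((k ∸ 1) · constant (J (k ∸ 2)) ⊛ x ⊕ constant (J (k ∸ 1))))
    × ((n : ℕ) → length (involutionsAvoiding (𝓕? k) (k + 2 * n)) ≡ (k ∸ 1) ^ (n + 1) * I (k ∸ 2))
    × ((n : ℕ) → length (involutionsAvoiding (𝓕? k) (k + 2 * n ∸ 1)) ≡ (k ∸ 1) ^ n * I (k ∸ 1))
-- The length `suc (suc k) + 2 * n ∸ 1` reduces to `suc k + 2 * n`, so `count-odd k` applies as it
-- is.
theorem3p1 (suc (suc k)) (s≤s (s≤s z≤n)) = F-closed-form k , count-even k , count-odd k
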